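{- The function $K(n) = h(2^n+1)$ is unbounded: for every real number $C$ there is a positive integer $n$ with $h(2^n+1) > C$.
   Context: $\sigma(m)$ is the sum of the positive divisors of a positive integer $m$ and $h(m)=\sigma(m)/m$. -}

module Defs where

open import Data.Nat using (ℕ; zero; suc; _+_; _^_; NonZero)
open import Data.Nat.Divisibility using (_∣?_)
open import Data.List using (List; filter)
open import Data.Nat.ListAction using (sum)
open import Data.List.Base using (upTo)
open import Data.Integer using (+_)
open import Data.Rational using (ℚ; _/_)

divisors : ℕ → List ℕ
divisors m = filter (λ d → d ∣? m) (Data.List.map suc (upTo m))

σ : ℕ → ℕ
σ m = sum (divisors m)

h : (m : ℕ) → .{{NonZero m}} → ℚ
h m = (+ σ m) / m

K : ℕ → ℚ
K n = h (suc (2 ^ n))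

{-# OPTIONS --safe #-}
-- Let χ be the character modulo 8 with χ(±1) = 1 and χ(±3) = -1.  A prime p with χ(p) = -1 is 3 or 5 modulo 8, so
-- 2^((p-1)/2) ≡ -1 (mod p) with (p-1)/2 odd in the first case and twice an odd number in the second; hence all
-- p ≡ 3 (mod 8) up to x divide a common 2^n + 1, and so do all p ≡ 5 (mod 8).  For such an n, h(2^n + 1) ≥ ∏ (1 + 1/p),
-- and it remains to see that one of the two products is unbounded.  The sums Σ_{m ≤ y} χ(m)/m are at most 1.  Sieving out
-- the multiples of a prime p with χ(p) = -1 multiplies the bound by 1 + 1/p, and after sieving by all such p ≤ x the
-- functions χ and χ² agree up to x.  Undoing the sieve for χ² costs a factor 1/(1 - 1/p) ≤ (1 + 1/p)² per prime.  So
-- Σ_{m ≤ x, m odd} 1/m ≤ ∏ (1 + 1/p)³ over all p ≤ x with χ(p) = -1, and the left side diverges.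
module Submission where

open import Defs
open import Data.Bool using (if_then_else_; true; false)
open import Data.Empty using (⊥-elim)
open import Data.Fin using (Fin; toℕ; fromℕ<)
open import Data.Fin.Properties using (all?; toℕ-fromℕ<)
import Data.Integer as ℤ
import Data.Integer.Divisibility.Signed as ℤ
import Data.Integer.Properties as ℤ
import Data.Integer.Tactic.RingSolver as ℤ
open import Data.List using (List; []; _∷_; _++_; filter; foldr; map; upTo)
open import Data.List.Membership.Propositional using (_∈_)
open import Data.List.Membership.Propositional.Properties using (∈-filter⁺; ∈-filter⁻; ∈-map⁺; ∈-map⁻; ∈-upTo⁺; ∈-++⁺ˡ; ∈-++⁺ʳ; ∈-++⁻; ∈-∃++)
open import Data.List.Relation.Unary.All as All using (All; []; _∷_)
import Data.List.Relation.Unary.All.Properties as All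
open import Data.List.Relation.Unary.AllPairs using ([]; _∷_)
open import Data.List.Relation.Unary.Any using (here; there)
open import Data.List.Relation.Unary.Unique.Propositional using (Unique)
import Data.List.Relation.Unary.Unique.Propositional.Properties as Unique
open import Data.Nat as ℕ using (ℕ; zero; suc; _≥_; _!; NonZero; s≤s; z≤n)
import Data.Nat.DivMod as ℕ
open import Data.Nat.Divisibility using (_∣_; _∣?_; divides; 1∣_; m∣m*n; n∣m*n; ∣n⇒∣m*n; ∣m+n∣m⇒∣n; *-monoʳ-∣; ∣-refl; ∣-trans; ∣⇒≤; ∣1⇒≡1; >⇒∤)
open import Data.Nat.Induction using (<-rec)
open import Data.Nat.ListAction using (product; sum)
open import Data.Nat.ListAction.Properties using (sum-++; ∈⇒∣product)
open import Data.Nat.Primality using (Prime; prime?; euclidsLemma; prime⇒irreducible; prime⇒nonTrivial; prime⇒nonZero; productOfPrimes≢0; ¬prime[1])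
open import Data.Nat.Primality.Factorisation using (factorise; PrimeFactorisation)
import Data.Nat.Properties as ℕ
import Data.Nat.Tactic.RingSolver as ℕ
open import Data.Product using (∃-syntax; _×_; _,_; proj₁; proj₂; map₂)
open import Data.Rational using (ℚ; mkℚ; _+_; _*_; _-_; -_; _/_; _≤_; _<_; *≤*; 0ℚ; 1ℚ; ½; nonNegative; toℚᵘ)
open import Data.Rational.Properties hiding (_≥?_)
open import Data.Rational.Unnormalised as ℚᵘ using (mkℚᵘ)
import Data.Rational.Unnormalised.Properties as ℚᵘ
open import Data.Sum using (_⊎_; inj₁; inj₂; [_,_])
open import Function using (_∘_)
open import Level using (0ℓ)
open import Relation.Binary.PropositionalEquality hiding ([_])
open import Relation.Nullary using (yes; no; does; ¬_; ¬?; Dec; _×-dec_; _⊎-dec_; _→-dec_)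
open import Relation.Nullary.Decidable using (dec-true; dec-false; dec⇒maybe; from-yes)
open import Tactic.RingSolver using (solve-∀)
open import Tactic.RingSolver.Core.AlmostCommutativeRing using (AlmostCommutativeRing; fromCommutativeRing)

-- Natural numbers and their reciprocals inside ℚ

ℚ-ring : AlmostCommutativeRing 0ℓ 0ℓ
ℚ-ring = fromCommutativeRing +-*-commutativeRing λ q → dec⇒maybe (0ℚ ≟ q)

ι : ℕ → ℚ
ι n = ℤ.+ n / 1

/-hom-* : ∀ a m b n .{{_ : NonZero m}} .{{_ : NonZero n}} .{{_ : NonZero (m ℕ.* n)}} →
  (ℤ.+ a / m) * (ℤ.+ b / n) ≡ ℤ.+ (a ℕ.* b) / (m ℕ.* n)
/-hom-* a m@(suc m-1) b n@(suc n-1) = toℚᵘ-injective (begin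
  toℚᵘ ((ℤ.+ a / m) * (ℤ.+ b / n))          ≈⟨ toℚᵘ-homo-* (ℤ.+ a / m) (ℤ.+ b / n) ⟩
  toℚᵘ (ℤ.+ a / m) ℚᵘ.* toℚᵘ (ℤ.+ b / n)    ≈⟨ ℚᵘ.*-cong (toℚᵘ-fromℚᵘ (mkℚᵘ (ℤ.+ a) m-1)) (toℚᵘ-fromℚᵘ (mkℚᵘ (ℤ.+ b) n-1)) ⟩
  mkℚᵘ (ℤ.+ a) m-1 ℚᵘ.* mkℚᵘ (ℤ.+ b) n-1    ≈⟨ ℚᵘ.*≡* (cong (ℤ._* (ℤ.+ (m ℕ.* n))) (sym (ℤ.pos-* a b))) ⟩
  mkℚᵘ (ℤ.+ (a ℕ.* b)) (n-1 ℕ.+ m-1 ℕ.* n)  ≈⟨ toℚᵘ-fromℚᵘ _ ⟨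
  toℚᵘ (ℤ.+ (a ℕ.* b) / (m ℕ.* n))          ∎)
  where open ℚᵘ.≃-Reasoning

ι-* : ∀ a b → ι (a ℕ.* b) ≡ ι a * ι b
ι-* a b = sym (/-hom-* a 1 b 1)

ι-+ : ∀ a b → ι (a ℕ.+ b) ≡ ι a + ι b
ι-+ a b = toℚᵘ-injective (begin
  toℚᵘ (ι (a ℕ.+ b))                  ≈⟨ toℚᵘ-fromℚᵘ (mkℚᵘ (ℤ.+ (a ℕ.+ b)) 0) ⟩
  mkℚᵘ (ℤ.+ (a ℕ.+ b)) 0              ≈⟨ ℚᵘ.*≡* (cong (ℤ._* ℤ.+ 1) (cong₂ ℤ._+_ (ℤ.*-identityʳ (ℤ.+ a)) (ℤ.*-identityʳ (ℤ.+ b)))) ⟨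
  mkℚᵘ (ℤ.+ a) 0 ℚᵘ.+ mkℚᵘ (ℤ.+ b) 0  ≈⟨ ℚᵘ.+-cong (toℚᵘ-fromℚᵘ (mkℚᵘ (ℤ.+ a) 0)) (toℚᵘ-fromℚᵘ (mkℚᵘ (ℤ.+ b) 0)) ⟨
  toℚᵘ (ι a) ℚᵘ.+ toℚᵘ (ι b)          ≈⟨ toℚᵘ-homo-+ (ι a) (ι b) ⟨
  toℚᵘ (ι a + ι b)                    ∎)
  where open ℚᵘ.≃-Reasoning

ι-mono-≤ : ∀ {a b} → a ℕ.≤ b → ι a ≤ ι b
ι-mono-≤ {a} {b} a≤b = toℚᵘ-cancel-≤ (begin
  toℚᵘ (ι a)      ≃⟨ toℚᵘ-fromℚᵘ (mkℚᵘ (ℤ.+ a) 0) ⟩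
  mkℚᵘ (ℤ.+ a) 0  ≤⟨ ℚᵘ.*≤* (ℤ.*-monoʳ-≤-nonNeg (ℤ.+ 1) (ℤ.+≤+ a≤b)) ⟩
  mkℚᵘ (ℤ.+ b) 0  ≃⟨ toℚᵘ-fromℚᵘ (mkℚᵘ (ℤ.+ b) 0) ⟨
  toℚᵘ (ι b)      ∎)
  where open ℚᵘ.≤-Reasoning

-- The value 0 at 0 makes `recip` total and keeps it completely multiplicative.
recip : ℕ → ℚ
recip zero      = 0ℚ
recip n@(suc _) = ℤ.+ 1 / n

/-as-* : ∀ a n .{{_ : NonZero n}} → ℤ.+ a / n ≡ ι a * recip n
/-as-* a n@(suc n-1) = sym (trans (/-hom-* a 1 1 n) (/-cong (cong ℤ.+_ (ℕ.*-identityʳ a)) (ℕ.*-identityˡ n)))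

recip-inverse : ∀ n .{{_ : NonZero n}} → ι n * recip n ≡ 1ℚ
recip-inverse n@(suc n-1) = begin
  ι n * recip n  ≡⟨ /-as-* n n ⟨
  ℤ.+ n / n      ≡⟨ fromℚᵘ-cong {mkℚᵘ (ℤ.+ n) n-1} {mkℚᵘ (ℤ.+ 1) 0} (ℚᵘ.*≡* (ℤ.*-comm (ℤ.+ n) (ℤ.+ 1))) ⟩
  1ℚ             ∎
  where open ≡-Reasoning

recip-* : ∀ m n → recip (m ℕ.* n) ≡ recip m * recip n
recip-* zero n = sym (*-zeroˡ (recip n))
recip-* m@(suc _) zero = trans (cong recip (ℕ.*-zeroʳ m)) (sym (*-zeroʳ (recip m)))
recip-* m@(suc _) n@(suc _) = sym (/-hom-* 1 m 1 n)

recip-nonneg : ∀ n → 0ℚ ≤ recip n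
recip-nonneg zero = ≤-refl
recip-nonneg n@(suc _) = nonNegative⁻¹ (recip n) {{normalize-nonNeg 1 n}}

*-monoˡ : ∀ {p q} r → 0ℚ ≤ r → p ≤ q → r * p ≤ r * q
*-monoˡ r 0≤r = *-monoˡ-≤-nonNeg r {{nonNegative 0≤r}}

*-monoʳ : ∀ {p q} r → 0ℚ ≤ r → p ≤ q → p * r ≤ q * r
*-monoʳ r 0≤r = *-monoʳ-≤-nonNeg r {{nonNegative 0≤r}}

0≤* : ∀ {p q} → 0ℚ ≤ p → 0ℚ ≤ q → 0ℚ ≤ p * q
0≤* {p} {q} 0≤p 0≤q = subst (_≤ p * q) (*-zeroʳ p) (*-monoˡ p 0≤p 0≤q)

recip-antimono : ∀ {m n} .{{_ : NonZero m}} → m ℕ.≤ n → recip n ≤ recip m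
recip-antimono {m} {n} m≤n = begin
  recip n                    ≡⟨ *-identityʳ (recip n) ⟨
  recip n * 1ℚ               ≡⟨ cong (recip n *_) (recip-inverse m) ⟨
  recip n * (ι m * recip m)  ≡⟨ *-assoc (recip n) (ι m) (recip m) ⟨
  recip n * ι m * recip m    ≤⟨ *-monoʳ (recip m) (recip-nonneg m) (*-monoˡ (recip n) (recip-nonneg n) (ι-mono-≤ m≤n)) ⟩
  recip n * ι n * recip m    ≡⟨ cong (_* recip m) (trans (*-comm (recip n) (ι n)) (recip-inverse n {{n≢0}})) ⟩
  1ℚ * recip m               ≡⟨ *-identityˡ (recip m) ⟩
  recip m                    ∎
  where
  open ≤-Reasoning
  n≢0 : NonZero n
  n≢0 = ℕ.>-nonZero (ℕ.≤-trans (ℕ.>-nonZero⁻¹ m) m≤n)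

-- Sieving

-- The partial sum of the Dirichlet series of `g` at s = 1; the value `g 0` never enters.
logSum : (ℕ → ℚ) → ℕ → ℚ
logSum g zero    = 0ℚ
logSum g (suc n) = logSum g n + g (suc n) * recip (suc n)

logSum-cong : ∀ {f g} n → (∀ m → m ℕ.≤ n → f m ≡ g m) → logSum f n ≡ logSum g n
logSum-cong zero    f≡g = refl
logSum-cong (suc n) f≡g = cong₂ (λ s t → s + t * recip (suc n))
  (logSum-cong n λ m m≤n → f≡g m (ℕ.m≤n⇒m≤1+n m≤n)) (f≡g (suc n) ℕ.≤-refl)

logSum-scale : ∀ c g n → logSum (λ m → c * g m) n ≡ c * logSum g n
logSum-scale c g zero    = sym (*-zeroʳ c)
logSum-scale c g (suc n) = trans (cong (_+ c * g (suc n) * recip (suc n)) (logSum-scale c g n))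
  (eq c (logSum g n) (g (suc n)) (recip (suc n)))
  where
  eq : ∀ c s t r → c * s + c * t * r ≡ c * (s + t * r)
  eq = solve-∀ ℚ-ring

logSum-+ : ∀ f g n → logSum (λ m → f m + g m) n ≡ logSum f n + logSum g n
logSum-+ f g zero    = refl
logSum-+ f g (suc n) = trans (cong (_+ (f (suc n) + g (suc n)) * recip (suc n)) (logSum-+ f g n))
  (eq (logSum f n) (logSum g n) (f (suc n)) (g (suc n)) (recip (suc n)))
  where
  eq : ∀ s t a b r → s + t + (a + b) * r ≡ s + a * r + (t + b * r)
  eq = solve-∀ ℚ-ring

p≤p+q : ∀ {p q} → 0ℚ ≤ q → p ≤ p + q
p≤p+q {p} {q} 0≤q = subst (_≤ p + q) (+-identityʳ p) (+-monoʳ-≤ p 0≤q)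

logSum-mono : ∀ {g m n} → (∀ i → 0ℚ ≤ g i) → m ℕ.≤′ n → logSum g m ≤ logSum g n
logSum-mono 0≤g ℕ.≤′-refl = ≤-refl
logSum-mono {n = suc n} 0≤g (ℕ.≤′-step m≤n) = ≤-trans (logSum-mono 0≤g m≤n) (p≤p+q (0≤* (0≤g (suc n)) (recip-nonneg (suc n))))

sieve : ℕ → (ℕ → ℚ) → ℕ → ℚ
sieve p g m = if does (p ∣? m) then 0ℚ else g m

multiples : ℕ → (ℕ → ℚ) → ℕ → ℚ
multiples p g m = if does (p ∣? m) then g m else 0ℚ

-- Induction on the last multiple `q * p` and the remainder `r`: terms past the last multiple
-- vanish, and the factor 1/p is pulled out of the weight of each multiple.
logSum-multiples : ∀ p g q r → r ℕ.< p → logSum (multiples p g) (r ℕ.+ q ℕ.* p) ≡ recip p * logSum (λ m → g (p ℕ.* m)) q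
logSum-multiples p g zero zero r<p = sym (*-zeroʳ (recip p))
logSum-multiples p@(suc p-1) g (suc q) zero r<p = begin
  logSum M (p-1 ℕ.+ q ℕ.* p) + M (suc q ℕ.* p) * recip (suc q ℕ.* p)
    ≡⟨ cong₂ _+_ (logSum-multiples p g q p-1 ℕ.≤-refl) (cong₂ _*_ M-value (recip-* (suc q) p)) ⟩
  recip p * logSum g′ q + g′ (suc q) * (recip (suc q) * recip p)
    ≡⟨ eq (recip p) (logSum g′ q) (g′ (suc q)) (recip (suc q)) ⟩
  recip p * (logSum g′ q + g′ (suc q) * recip (suc q)) ∎
  where
  open ≡-Reasoning
  M = multiples p g
  g′ = λ m → g (p ℕ.* m)
  M-value : M (suc q ℕ.* p) ≡ g′ (suc q)
  M-value rewrite dec-true (p ∣? suc q ℕ.* p) (n∣m*n (suc q)) = cong g (ℕ.*-comm (suc q) p)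
  eq : ∀ u s a v → u * s + a * (v * u) ≡ u * (s + a * v)
  eq = solve-∀ ℚ-ring
logSum-multiples p g q (suc r) r<p
  rewrite dec-false (p ∣? suc r ℕ.+ q ℕ.* p) (λ p∣ → >⇒∤ r<p (∣m+n∣m⇒∣n (subst (p ∣_) (ℕ.+-comm (suc r) (q ℕ.* p)) p∣) (n∣m*n q)))
  = trans (trans (cong (logSum (multiples p g) (r ℕ.+ q ℕ.* p) +_) (*-zeroˡ (recip (suc (r ℕ.+ q ℕ.* p)))))
                 (+-identityʳ _))
          (logSum-multiples p g q r (ℕ.<-trans (ℕ.n<1+n r) r<p))

-- The multiples of `p` up to `y` are `p * m` with `m ≤ y / p`, and the twist makes each contribute
-- `c / p` times the term of `g` at `m`. Sieving and unsieving both rest on this identity.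
logSum-sieve : ∀ p .{{_ : NonZero p}} {g} c → (∀ m → g (p ℕ.* m) ≡ c * g m) → ∀ y →
  logSum g y ≡ logSum (sieve p g) y + c * (recip p * logSum g (y ℕ./ p))
logSum-sieve p {g} c twist y = begin
  logSum g y
    ≡⟨ logSum-cong y (λ m _ → split m) ⟩
  logSum (λ m → sieve p g m + multiples p g m) y
    ≡⟨ logSum-+ (sieve p g) (multiples p g) y ⟩
  logSum (sieve p g) y + logSum (multiples p g) y
    ≡⟨ cong (λ z → logSum (sieve p g) y + logSum (multiples p g) z) (ℕ.m≡m%n+[m/n]*n y p) ⟩
  logSum (sieve p g) y + logSum (multiples p g) (y ℕ.% p ℕ.+ y ℕ./ p ℕ.* p)
    ≡⟨ cong (logSum (sieve p g) y +_) (logSum-multiples p g (y ℕ./ p) (y ℕ.% p) (ℕ.m%n<n y p)) ⟩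
  logSum (sieve p g) y + recip p * logSum (λ m → g (p ℕ.* m)) (y ℕ./ p)
    ≡⟨ cong (λ z → logSum (sieve p g) y + recip p * z) (trans (logSum-cong (y ℕ./ p) (λ m _ → twist m)) (logSum-scale c g (y ℕ./ p))) ⟩
  logSum (sieve p g) y + recip p * (c * logSum g (y ℕ./ p))
    ≡⟨ cong (logSum (sieve p g) y +_) (eq (recip p) c (logSum g (y ℕ./ p))) ⟩
  logSum (sieve p g) y + c * (recip p * logSum g (y ℕ./ p)) ∎
  where
  open ≡-Reasoning
  split : ∀ m → g m ≡ sieve p g m + multiples p g m
  split m with does (p ∣? m)
  ... | true  = sym (+-identityˡ (g m))
  ... | false = sym (+-identityʳ (g m))
  eq : ∀ u c s → u * (c * s) ≡ c * (u * s)
  eq = solve-∀ ℚ-ring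

sieves : List ℕ → (ℕ → ℚ) → ℕ → ℚ
sieves ps g = foldr sieve g ps

∣prime⇒≡ : ∀ {p q} → Prime p → Prime q → p ∣ q → p ≡ q
∣prime⇒≡ pp pq p∣q with prime⇒irreducible pq p∣q
... | inj₁ refl = ⊥-elim (¬prime[1] pp)
... | inj₂ p≡q = p≡q

-- A prime `p` other than `q` divides `q * m` exactly when it divides `m`, so sieving by such primes
-- commutes with dilation by `q`.
sieves-twist : ∀ {q ps g} c → Prime q → All Prime ps → All (q ≢_) ps →
  (∀ m → g (q ℕ.* m) ≡ c * g m) → ∀ m → sieves ps g (q ℕ.* m) ≡ c * sieves ps g m
sieves-twist c prime-q [] [] twist m = twist m
sieves-twist {q} {p ∷ ps} {g} c prime-q (prime-p ∷ primes) (q≢p ∷ q∉ps) twist m with p ∣? m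
... | yes p∣m rewrite dec-true (p ∣? q ℕ.* m) (∣n⇒∣m*n q p∣m) = sym (*-zeroʳ c)
... | no  p∤m rewrite dec-false (p ∣? q ℕ.* m) ([ q≢p ∘ sym ∘ ∣prime⇒≡ prime-p prime-q , p∤m ] ∘ euclidsLemma q m prime-p) =
  sieves-twist c prime-q primes q∉ps twist m

Π : List ℕ → ℚ
Π []       = 1ℚ
Π (p ∷ ps) = (1ℚ + recip p) * Π ps

Π-++ : ∀ ps qs → Π (ps ++ qs) ≡ Π ps * Π qs
Π-++ []       qs = sym (*-identityˡ (Π qs))
Π-++ (p ∷ ps) qs = trans (cong ((1ℚ + recip p) *_) (Π-++ ps qs)) (sym (*-assoc (1ℚ + recip p) (Π ps) (Π qs)))

0≤1 : 0ℚ ≤ 1ℚ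
0≤1 = from-yes (0ℚ ≤? 1ℚ)

0≤1+recip : ∀ p → 0ℚ ≤ 1ℚ + recip p
0≤1+recip p = ≤-trans 0≤1 (p≤p+q (recip-nonneg p))

Π-nonneg : ∀ ps → 0ℚ ≤ Π ps
Π-nonneg []       = 0≤1
Π-nonneg (p ∷ ps) = 0≤* (0≤1+recip p) (Π-nonneg ps)

-- The part of complete multiplicativity that survives sieving by other primes, with `c` as the
-- value of `g` at `p`.
Twist : (ℕ → ℚ) → ℚ → ℕ → Set
Twist g c p = ∀ m → g (p ℕ.* m) ≡ c * g m

-- For `c = - 1ℚ`, `logSum-sieve` expresses the sieved sum at `y` as the unsieved one at `y` plus
-- 1/p times that at `y / p`. Both enter with a plus sign, so a one-sided bound uniform in `y`
-- passes on with the factor `1 + 1/p`.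
logSum-sieves-upper : ∀ {g B ps} → (∀ y → logSum g y ≤ B) →
  All Prime ps → Unique ps → All (Twist g (- 1ℚ)) ps → ∀ y → logSum (sieves ps g) y ≤ Π ps * B
logSum-sieves-upper {B = B} bound [] [] [] y = ≤-trans (bound y) (≤-reflexive (sym (*-identityˡ B)))
logSum-sieves-upper {g} {B} {p ∷ ps} bound (prime-p ∷ primes) (p∉ps ∷ unique) (twist ∷ twists) y = begin
  logSum (sieve p G) y
    ≡⟨ eq (logSum (sieve p G) y) (recip p * logSum G (y ℕ./ p)) ⟩
  logSum (sieve p G) y + - 1ℚ * (recip p * logSum G (y ℕ./ p)) + recip p * logSum G (y ℕ./ p)
    ≡⟨ cong (_+ recip p * logSum G (y ℕ./ p)) (logSum-sieve p (- 1ℚ) (sieves-twist (- 1ℚ) prime-p primes p∉ps twist) y) ⟨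
  logSum G y + recip p * logSum G (y ℕ./ p)
    ≤⟨ +-mono-≤ (IH y) (*-monoˡ (recip p) (recip-nonneg p) (IH (y ℕ./ p))) ⟩
  Π ps * B + recip p * (Π ps * B)
    ≡⟨ eq′ (recip p) (Π ps) B ⟩
  (1ℚ + recip p) * Π ps * B ∎
  where
  open ≤-Reasoning
  instance _ = prime⇒nonZero prime-p
  G = sieves ps g
  IH = logSum-sieves-upper bound primes unique twists
  eq : ∀ s t → s ≡ s + - 1ℚ * t + t
  eq = solve-∀ ℚ-ring
  eq′ : ∀ u P B → P * B + u * (P * B) ≡ (1ℚ + u) * P * B
  eq′ = solve-∀ ℚ-ring

-- For u ≤ 1/2 this is 1 / (1 - u) ≤ (1 + u)².
geometric : ∀ u → 0ℚ ≤ u → u ≤ ½ → 1ℚ + (1ℚ + u) * (1ℚ + u) * u ≤ (1ℚ + u) * (1ℚ + u)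
geometric u 0≤u u≤½ = begin
  1ℚ + (1ℚ + u) * (1ℚ + u) * u          ≡⟨ eq u ⟩
  (1ℚ + u + u * (u + u)) + u * (u * u)  ≤⟨ +-mono-≤ (+-monoʳ-≤ (1ℚ + u) (*-monoˡ u 0≤u (+-mono-≤ u≤½ u≤½))) (*-monoˡ u 0≤u uu≤u) ⟩
  (1ℚ + u + u * 1ℚ) + u * u             ≡⟨ eq′ u ⟩
  (1ℚ + u) * (1ℚ + u)                   ∎
  where
  open ≤-Reasoning
  uu≤u : u * u ≤ u
  uu≤u = ≤-trans (*-monoˡ u 0≤u (≤-trans u≤½ (from-yes (½ ≤? 1ℚ)))) (≤-reflexive (*-identityʳ u))
  eq : ∀ u → 1ℚ + (1ℚ + u) * (1ℚ + u) * u ≡ (1ℚ + u + u * (u + u)) + u * (u * u)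
  eq = solve-∀ ℚ-ring
  eq′ : ∀ u → (1ℚ + u + u * 1ℚ) + u * u ≡ (1ℚ + u) * (1ℚ + u)
  eq′ = solve-∀ ℚ-ring

-- Strong induction on `y`: `logSum g y` is at most `B + D / p` for the claimed bound `D`, and this
-- is at most `D` by `geometric`. The range is limited to `y ≤ x` because the sieved sums will be
-- controlled only there.
logSum-unsieve : ∀ {p g B x} → 2 ℕ.≤ p → Twist g 1ℚ p →
  (∀ y → y ℕ.≤ x → logSum (sieve p g) y ≤ B) →
  ∀ y → y ℕ.≤ x → logSum g y ≤ (1ℚ + recip p) * (1ℚ + recip p) * B
logSum-unsieve {p@(suc p-1)} {g} {B} {x} 2≤p twist bound = <-rec _ step
  where
  open ≤-Reasoning
  u = recip p
  D = (1ℚ + u) * (1ℚ + u) * B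
  0≤B : 0ℚ ≤ B
  -- The sum up to 0 is empty.
  0≤B = bound 0 z≤n
  step : ∀ y → (∀ {z} → z ℕ.< y → z ℕ.≤ x → logSum g z ≤ D) → y ℕ.≤ x → logSum g y ≤ D
  step zero rec _ = 0≤* (0≤* (0≤1+recip p) (0≤1+recip p)) 0≤B
  step y@(suc _) rec y≤x = begin
    logSum g y                                            ≡⟨ logSum-sieve p 1ℚ twist y ⟩
    logSum (sieve p g) y + 1ℚ * (u * logSum g (y ℕ./ p))  ≡⟨ cong (logSum (sieve p g) y +_) (*-identityˡ (u * logSum g (y ℕ./ p))) ⟩
    logSum (sieve p g) y + u * logSum g (y ℕ./ p)
      ≤⟨ +-mono-≤ (bound y y≤x) (*-monoˡ u (recip-nonneg p) (rec y/p<y (ℕ.≤-trans (ℕ.<⇒≤ y/p<y) y≤x))) ⟩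
    B + u * D                                         ≡⟨ eq B u ⟩
    (1ℚ + (1ℚ + u) * (1ℚ + u) * u) * B
      -- Since `2 ≤ p`, `recip p` is at most `recip 2`, which is ½.
      ≤⟨ *-monoʳ B 0≤B (geometric u (recip-nonneg p) (recip-antimono 2≤p)) ⟩
    D ∎
    where
    y/p<y : y ℕ./ p ℕ.< y
    y/p<y = ℕ.m/n<m y p 2≤p
    eq : ∀ B u → B + u * ((1ℚ + u) * (1ℚ + u) * B) ≡ (1ℚ + (1ℚ + u) * (1ℚ + u) * u) * B
    eq = solve-∀ ℚ-ring

prime⇒2≤ : ∀ {p} → Prime p → 2 ℕ.≤ p
prime⇒2≤ prime-p = ℕ.nonTrivial⇒n>1 _ {{prime⇒nonTrivial prime-p}}

-- The head of the list is the outermost sieve and is undone first; `sieves-twist` supplies its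
-- twist for the function already sieved by the tail.
logSum-unsieves : ∀ {g B x ps} → All Prime ps → Unique ps → All (Twist g 1ℚ) ps →
  (∀ y → y ℕ.≤ x → logSum (sieves ps g) y ≤ B) →
  ∀ y → y ℕ.≤ x → logSum g y ≤ Π ps * Π ps * B
logSum-unsieves {B = B} [] [] [] bound y y≤x = ≤-trans (bound y y≤x) (≤-reflexive (sym (*-identityˡ B)))
logSum-unsieves {g} {B} {x} {p ∷ ps} (prime-p ∷ primes) (p∉ps ∷ unique) (twist ∷ twists) bound y y≤x =
  ≤-trans
    (logSum-unsieves primes unique twists
      (logSum-unsieve (prime⇒2≤ prime-p) (sieves-twist 1ℚ prime-p primes p∉ps twist) bound) y y≤x)
    (≤-reflexive (eq (1ℚ + recip p) (Π ps) B))
  where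
  eq : ∀ e P B → P * P * (e * e * B) ≡ e * P * (e * P) * B
  eq = solve-∀ ℚ-ring

-- The quadratic character of ℚ(√2)

χ : ℕ → ℚ
χ 0 = 0ℚ
χ 1 = 1ℚ
χ 2 = 0ℚ
χ 3 = - 1ℚ
χ 4 = 0ℚ
χ 5 = - 1ℚ
χ 6 = 0ℚ
χ 7 = 1ℚ
χ (suc (suc (suc (suc (suc (suc (suc (suc n)))))))) = χ n

χ-periodic : ∀ n k → χ (n ℕ.+ k ℕ.* 8) ≡ χ n
χ-periodic n zero    = cong χ (ℕ.+-identityʳ n)
χ-periodic n (suc k) = trans (cong χ (eq n (k ℕ.* 8))) (χ-periodic n k)
  where
  eq : ∀ n m → n ℕ.+ (8 ℕ.+ m) ≡ 8 ℕ.+ (n ℕ.+ m)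
  eq = ℕ.solve-∀

χ-% : ∀ n → χ n ≡ χ (n ℕ.% 8)
χ-% n = trans (cong χ (ℕ.m≡m%n+[m/n]*n n 8)) (χ-periodic (n ℕ.% 8) (n ℕ./ 8))

-- Reduces a property of residues modulo 8 to eight cases, which a decision procedure can often
-- settle.
residues₈ : ∀ {P : ℕ → Set} → (∀ (i : Fin 8) → P (toℕ i)) → ∀ n → P (n ℕ.% 8)
residues₈ {P} all n = subst P (toℕ-fromℕ< (ℕ.m%n<n n 8)) (all (fromℕ< (ℕ.m%n<n n 8)))

-- Both sides depend only on `m` and `n` modulo 8, which leaves a table of 64 products.
χ-* : ∀ m n → χ (m ℕ.* n) ≡ χ m * χ n
χ-* m n = begin
  χ (m ℕ.* n)                        ≡⟨ χ-% (m ℕ.* n) ⟩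
  χ (m ℕ.* n ℕ.% 8)                  ≡⟨ cong χ (ℕ.%-distribˡ-* m n 8) ⟩
  χ ((m ℕ.% 8) ℕ.* (n ℕ.% 8) ℕ.% 8)  ≡⟨ χ-% ((m ℕ.% 8) ℕ.* (n ℕ.% 8)) ⟨
  χ ((m ℕ.% 8) ℕ.* (n ℕ.% 8))
    ≡⟨ residues₈ {λ r → χ (r ℕ.* (n ℕ.% 8)) ≡ χ r * χ (n ℕ.% 8)}
         (λ i → residues₈ {λ r → χ (toℕ i ℕ.* r) ≡ χ (toℕ i) * χ r} (table i) n) m ⟩
  χ (m ℕ.% 8) * χ (n ℕ.% 8)  ≡⟨ cong₂ _*_ (χ-% m) (χ-% n) ⟨
  χ m * χ n                  ∎
  where
  open ≡-Reasoning
  table : ∀ (i j : Fin 8) → χ (toℕ i ℕ.* toℕ j) ≡ χ (toℕ i) * χ (toℕ j)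
  table = from-yes (all? {n = 8} λ i → all? {n = 8} λ j → χ (toℕ i ℕ.* toℕ j) ≟ χ (toℕ i) * χ (toℕ j))

-- The principal character modulo 8, that is, the indicator function of the odd numbers.
χ² : ℕ → ℚ
χ² n = χ n * χ n

χ²-nonneg : ∀ n → 0ℚ ≤ χ² n
χ²-nonneg n = subst (λ c → 0ℚ ≤ c * c) (sym (χ-% n))
  (residues₈ {λ r → 0ℚ ≤ χ² r} (from-yes (all? {n = 8} λ i → 0ℚ ≤? χ² (toℕ i))) n)

-- In every period the term of 8k + 3 dominates that of 8k + 7, and the term of 8k + 5 that of 8k + 9.
χ-block : ∀ k → let n = k ℕ.* 8 in logSum χ (1 ℕ.+ n) ≤ 1ℚ →
  (∀ (i : Fin 8) → logSum χ (suc (toℕ i) ℕ.+ n) ≤ 1ℚ) × logSum χ (9 ℕ.+ n) ≤ 1ℚ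
χ-block k s≤1 = All.tabulate⁻ {P = λ j → logSum χ (j ℕ.+ n) ≤ 1ℚ} {f = λ i → suc (toℕ i)}
    (All.map (λ t≤s → ≤-trans t≤s s≤1)
    (_∷_ {P = λ j → logSum χ (j ℕ.+ n) ≤ s} ≤-refl (s₂ ∷ s₃ ∷ s₄ ∷ s₅ ∷ s₆ ∷ s₇ ∷ s₈ ∷ []))) , ≤-trans s₉ s≤1
  where
  open ≤-Reasoning
  n = k ℕ.* 8
  s = logSum χ (1 ℕ.+ n)
  r : ℕ → ℚ
  r j = recip (j ℕ.+ n)
  zero-step : ∀ j → χ (suc j) ≡ 0ℚ → logSum χ (suc j ℕ.+ n) ≡ logSum χ (j ℕ.+ n)
  zero-step j χ≡0 rewrite χ-periodic (suc j) k | χ≡0 = trans (cong (logSum χ (j ℕ.+ n) +_) (*-zeroˡ (r (suc j)))) (+-identityʳ _)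
  minus-step : ∀ j → χ (suc j) ≡ - 1ℚ → logSum χ (suc j ℕ.+ n) ≡ logSum χ (j ℕ.+ n) - r (suc j)
  minus-step j χ≡-1 rewrite χ-periodic (suc j) k | χ≡-1 = eq (logSum χ (j ℕ.+ n)) (r (suc j))
    where
    eq : ∀ a b → a + - 1ℚ * b ≡ a - b
    eq = solve-∀ ℚ-ring
  plus-step : ∀ j → χ (suc j) ≡ 1ℚ → logSum χ (suc j ℕ.+ n) ≡ logSum χ (j ℕ.+ n) + r (suc j)
  plus-step j χ≡1 rewrite χ-periodic (suc j) k | χ≡1 = cong (logSum χ (j ℕ.+ n) +_) (*-identityˡ (r (suc j)))
  drop : ∀ t j → t - r j ≤ t
  drop t j = subst (t - r j ≤_) (+-identityʳ t) (+-monoʳ-≤ t (neg-antimono-≤ (recip-nonneg (j ℕ.+ n))))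
  s₂ : logSum χ (2 ℕ.+ n) ≤ s
  s₂ = ≤-reflexive (zero-step 1 refl)
  e₃ : logSum χ (3 ℕ.+ n) ≡ s - r 3
  e₃ = trans (minus-step 2 refl) (cong (_- r 3) (zero-step 1 refl))
  s₃ : logSum χ (3 ℕ.+ n) ≤ s
  s₃ = ≤-trans (≤-reflexive e₃) (drop s 3)
  e₄ : logSum χ (4 ℕ.+ n) ≡ s - r 3
  e₄ = trans (zero-step 3 refl) e₃
  s₄ : logSum χ (4 ℕ.+ n) ≤ s
  s₄ = ≤-trans (≤-reflexive e₄) (drop s 3)
  e₅ : logSum χ (5 ℕ.+ n) ≡ s - r 3 - r 5
  e₅ = trans (minus-step 4 refl) (cong (_- r 5) e₄)
  s₅ : logSum χ (5 ℕ.+ n) ≤ s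
  s₅ = ≤-trans (≤-reflexive e₅) (≤-trans (drop (s - r 3) 5) (drop s 3))
  e₆ : logSum χ (6 ℕ.+ n) ≡ s - r 3 - r 5
  e₆ = trans (zero-step 5 refl) e₅
  s₆ : logSum χ (6 ℕ.+ n) ≤ s
  s₆ = ≤-trans (≤-reflexive e₆) (≤-trans (drop (s - r 3) 5) (drop s 3))
  e₇ : logSum χ (7 ℕ.+ n) ≡ s - r 3 - r 5 + r 7
  e₇ = trans (plus-step 6 refl) (cong (_+ r 7) e₆)
  u₇ : s - r 3 - r 5 + r 7 ≤ s - r 5
  u₇ = begin
    s - r 3 - r 5 + r 7  ≤⟨ +-monoʳ-≤ (s - r 3 - r 5) (recip-antimono (ℕ.+-monoˡ-≤ n (ℕ.m≤n+m 3 4))) ⟩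
    s - r 3 - r 5 + r 3  ≡⟨ eq s (r 3) (r 5) ⟩
    s - r 5              ∎
    where
    eq : ∀ s a b → s - a - b + a ≡ s - b
    eq = solve-∀ ℚ-ring
  s₇ : logSum χ (7 ℕ.+ n) ≤ s
  s₇ = ≤-trans (≤-reflexive e₇) (≤-trans u₇ (drop s 5))
  e₈ : logSum χ (8 ℕ.+ n) ≡ s - r 3 - r 5 + r 7
  e₈ = trans (zero-step 7 refl) e₇
  s₈ : logSum χ (8 ℕ.+ n) ≤ s
  s₈ = ≤-trans (≤-reflexive e₈) (≤-trans u₇ (drop s 5))
  s₉ : logSum χ (9 ℕ.+ n) ≤ s
  s₉ = begin
    logSum χ (9 ℕ.+ n)         ≡⟨ trans (plus-step 8 refl) (cong (_+ r 9) e₈) ⟩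
    s - r 3 - r 5 + r 7 + r 9  ≤⟨ +-mono-≤ u₇ (recip-antimono (ℕ.+-monoˡ-≤ n (ℕ.m≤n+m 5 4))) ⟩
    s - r 5 + r 5              ≡⟨ eq s (r 5) ⟩
    s                          ∎
    where
    eq : ∀ s a → s - a + a ≡ s
    eq = solve-∀ ℚ-ring

χ-bounded : ∀ y → logSum χ y ≤ 1ℚ
χ-bounded zero = 0≤1
-- The blocks of `χ-block` start at residue 1, so `suc y` is at offset `suc (y % 8)` from the
-- multiple `(y / 8) * 8`.
χ-bounded (suc y) = subst (λ z → logSum χ (suc z) ≤ 1ℚ) (sym (ℕ.m≡m%n+[m/n]*n y 8))
  (residues₈ {λ j → logSum χ (suc j ℕ.+ y ℕ./ 8 ℕ.* 8) ≤ 1ℚ} (proj₁ (χ-block (y ℕ./ 8) (first (y ℕ./ 8)))) y)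
  where
  first : ∀ k → logSum χ (1 ℕ.+ k ℕ.* 8) ≤ 1ℚ
  first zero    = from-yes (logSum χ 1 ≤? 1ℚ)
  first (suc k) = proj₂ (χ-block k (first k))

-- Divergence of the sum of 1/m over odd m

archimedes : ∀ q → ∃[ n ] q ≤ ι n
archimedes (mkℚ (ℤ.-[1+ a ]) d-1 c) = 0 , *≤* (ℤ.≤-trans (ℤ.≤-reflexive (ℤ.*-identityʳ (ℤ.-[1+ a ]))) ℤ.-≤+)
archimedes q@(mkℚ (ℤ.+ a) d-1 c) = a , (begin
  q                      ≡⟨ ↥p/↧p≡p q ⟨
  ℤ.+ a / suc d-1        ≡⟨ /-as-* a (suc d-1) ⟩
  ι a * recip (suc d-1)  ≤⟨ *-monoˡ (ι a) (ι-mono-≤ {0} {a} z≤n) (recip-antimono {1} {suc d-1} (s≤s z≤n)) ⟩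
  ι a * 1ℚ               ≡⟨ *-identityʳ (ι a) ⟩
  ι a                    ∎)
  where open ≤-Reasoning

one : ℕ → ℚ
one _ = 1ℚ

-- Each of the `j` terms after the first `n` is at least `1 / N`.
harmonic-tail : ∀ {N} n j → n ℕ.+ j ℕ.≤ N → logSum one n + ι j * recip N ≤ logSum one (n ℕ.+ j)
harmonic-tail {N} n zero _ rewrite ℕ.+-identityʳ n = ≤-reflexive (trans (cong (logSum one n +_) (*-zeroˡ (recip N))) (+-identityʳ (logSum one n)))
harmonic-tail {N} n (suc j) n+j≤N rewrite ℕ.+-suc n j = begin
  logSum one n + ι (suc j) * recip N                 ≡⟨ cong (λ z → logSum one n + z * recip N) (ι-+ 1 j) ⟩
  logSum one n + (1ℚ + ι j) * recip N                ≡⟨ eq (logSum one n) (ι j) (recip N) ⟩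
  logSum one n + ι j * recip N + 1ℚ * recip N        ≤⟨ +-mono-≤ (harmonic-tail n j (ℕ.<⇒≤ n+j≤N)) (*-monoˡ 1ℚ 0≤1 (recip-antimono n+j≤N)) ⟩
  logSum one (n ℕ.+ j) + 1ℚ * recip (suc (n ℕ.+ j))  ∎
  where
  open ≤-Reasoning
  eq : ∀ s i r → s + (1ℚ + i) * r ≡ s + i * r + 1ℚ * r
  eq = solve-∀ ℚ-ring

-- Oresme's argument: the terms from `n + 1` to `2n` add at least `n / 2n`, which is 1/2.
harmonic-diverges : ∀ k → ι k * ½ ≤ logSum one (2 ℕ.^ k)
harmonic-diverges zero = from-yes (ι 0 * ½ ≤? logSum one 1)
harmonic-diverges (suc k) = begin
  ι (suc k) * ½                         ≡⟨ cong (_* ½) (ι-+ 1 k) ⟩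
  (1ℚ + ι k) * ½                        ≡⟨ eq (ι k) ½ ⟩
  ι k * ½ + 1ℚ * ½                      ≤⟨ +-mono-≤ (harmonic-diverges k) (≤-reflexive half) ⟩
  logSum one n + ι n * recip (n ℕ.+ n)  ≤⟨ harmonic-tail n n ℕ.≤-refl ⟩
  logSum one (n ℕ.+ n)                  ≡⟨ cong (λ z → logSum one (n ℕ.+ z)) (ℕ.+-identityʳ n) ⟨
  logSum one (2 ℕ.^ suc k)              ∎
  where
  open ≤-Reasoning
  n = 2 ℕ.^ k
  eq : ∀ i h → (1ℚ + i) * h ≡ i * h + 1ℚ * h
  eq = solve-∀ ℚ-ring
  half : 1ℚ * ½ ≡ ι n * recip (n ℕ.+ n)
  half = ≡.begin
    1ℚ * ½                     ≡.≡⟨ cong (_* ½) (recip-inverse n {{ℕ.m^n≢0 2 k}}) ⟨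
    ι n * recip n * recip 2    ≡.≡⟨ *-assoc (ι n) (recip n) (recip 2) ⟩
    ι n * (recip n * recip 2)  ≡.≡⟨ cong (ι n *_) (recip-* n 2) ⟨
    ι n * recip (n ℕ.* 2)      ≡.≡⟨ cong (λ z → ι n * recip z) (double n) ⟩
    ι n * recip (n ℕ.+ n)      ≡.∎
    where
    module ≡ = ≡-Reasoning
    double : ∀ n → n ℕ.* 2 ≡ n ℕ.+ n
    double = ℕ.solve-∀

-- From each period of `χ²` only the term at `8k + 1` is kept, and `1 / (8k + 1)` is at least
-- `1 / (8 (k + 1))`.
χ²-harmonic : ∀ k → recip 8 * logSum one k ≤ logSum χ² (k ℕ.* 8)
χ²-harmonic zero = ≤-reflexive (*-zeroʳ (recip 8))
χ²-harmonic (suc k) = begin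
  recip 8 * (logSum one k + 1ℚ * recip (suc k))            ≡⟨ eq (recip 8) (logSum one k) (recip (suc k)) ⟩
  recip 8 * logSum one k + 1ℚ * (recip (suc k) * recip 8)  ≡⟨ cong (λ z → recip 8 * logSum one k + 1ℚ * z) (recip-* (suc k) 8) ⟨
  recip 8 * logSum one k + 1ℚ * recip (suc k ℕ.* 8)        ≤⟨ +-mono-≤ (χ²-harmonic k) (*-monoˡ 1ℚ 0≤1 (recip-antimono (s≤s (ℕ.m≤n+m (k ℕ.* 8) 7)))) ⟩
  logSum χ² (k ℕ.* 8) + 1ℚ * recip (1 ℕ.+ k ℕ.* 8)         ≡⟨ cong (λ c → logSum χ² (k ℕ.* 8) + c * c * recip (1 ℕ.+ k ℕ.* 8)) (χ-periodic 1 k) ⟨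
  logSum χ² (1 ℕ.+ k ℕ.* 8)                                ≤⟨ logSum-mono {χ²} χ²-nonneg (ℕ.≤⇒≤′ (s≤s (ℕ.m≤n+m (k ℕ.* 8) 7))) ⟩
  logSum χ² (suc k ℕ.* 8)                                  ∎
  where
  open ≤-Reasoning
  eq : ∀ e s r → e * (s + 1ℚ * r) ≡ e * s + 1ℚ * (r * e)
  eq = solve-∀ ℚ-ring

χ²-lower : ∀ k → recip 8 * (ι k * ½) ≤ logSum χ² (2 ℕ.^ k ℕ.* 8)
χ²-lower k = ≤-trans (*-monoˡ (recip 8) (recip-nonneg 8) (harmonic-diverges k)) (χ²-harmonic (2 ℕ.^ k))

ι-sixteenth : ∀ T → recip 8 * (ι (16 ℕ.* T) * ½) ≡ ι T
ι-sixteenth T = begin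
  recip 8 * (ι (16 ℕ.* T) * ½)  ≡⟨ cong (λ z → recip 8 * (z * ½)) (ι-* 16 T) ⟩
  recip 8 * (ι 16 * ι T * ½)    ≡⟨ eq (recip 8) (ι 16) ½ (ι T) ⟩
  recip 8 * (ι 16 * ½) * ι T    ≡⟨ cong (_* ι T) one-eighth-of-eight ⟩
  1ℚ * ι T                      ≡⟨ *-identityˡ (ι T) ⟩
  ι T                           ∎
  where
  open ≡-Reasoning
  one-eighth-of-eight : recip 8 * (ι 16 * ½) ≡ 1ℚ
  one-eighth-of-eight = refl
  eq : ∀ a b c d → a * (b * d * c) ≡ a * (b * c) * d
  eq = solve-∀ ℚ-ring

χ²-unbounded : ∀ H → ∃[ x ] H < logSum χ² x
χ²-unbounded H with archimedes H
-- The factor 16 cancels the 1/8 and the 1/2 in `χ²-lower`; the successor makes the inequality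
-- strict.
... | T , H≤T = 2 ℕ.^ (16 ℕ.* suc T) ℕ.* 8 , <-≤-trans H<1+T
  (subst (_≤ logSum χ² (2 ℕ.^ (16 ℕ.* suc T) ℕ.* 8)) (ι-sixteenth (suc T)) (χ²-lower (16 ℕ.* suc T)))
  where
  open ≤-Reasoning
  H<1+T : H < ι (suc T)
  H<1+T = begin-strict
    H          ≤⟨ H≤T ⟩
    ι T        ≡⟨ +-identityˡ (ι T) ⟨
    0ℚ + ι T   <⟨ +-monoˡ-< (ι T) (from-yes (0ℚ <? 1ℚ)) ⟩
    1ℚ + ι T   ≡⟨ ι-+ 1 T ⟨
    ι (suc T)  ∎

-- The primes with character value -1 and the product over them

PrimeMod8 : ℕ → ℕ → Set
PrimeMod8 r p = Prime p × p ℕ.% 8 ≡ r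

primeMod8? : ∀ r p → Dec (PrimeMod8 r p)
primeMod8? r p = prime? p ×-dec (p ℕ.% 8 ℕ.≟ r)

primesMod8 : ℕ → ℕ → List ℕ
primesMod8 r x = filter (primeMod8? r) (upTo (suc x))

primesMod8-unique : ∀ r x → Unique (primesMod8 r x)
primesMod8-unique r x = Unique.filter⁺ (primeMod8? r) (Unique.upTo⁺ (suc x))

primesMod8-sound : ∀ r x → All (PrimeMod8 r) (primesMod8 r x)
primesMod8-sound r x = All.all-filter (primeMod8? r) (upTo (suc x))

primesMod8-complete : ∀ {r x p} → p ℕ.≤ x → PrimeMod8 r p → p ∈ primesMod8 r x
primesMod8-complete {r} p≤x = ∈-filter⁺ (primeMod8? r) (∈-upTo⁺ (s≤s p≤x))

-- The primes up to `x` at which `χ` is -1, which are those that stay prime in ℤ[√2].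
inert : ℕ → List ℕ
inert x = primesMod8 3 x ++ primesMod8 5 x

inert-unique : ∀ x → Unique (inert x)
inert-unique x = Unique.++⁺ (primesMod8-unique 3 x) (primesMod8-unique 5 x)
  λ (p∈₃ , p∈₅) → case-≢ (trans (sym (proj₂ (All.lookup (primesMod8-sound 3 x) p∈₃)))
                          (proj₂ (All.lookup (primesMod8-sound 5 x) p∈₅)))
  where
  case-≢ : 3 ≢ 5
  case-≢ ()

inert-sound : ∀ x → All (λ p → Prime p × χ p ≡ - 1ℚ) (inert x)
inert-sound x = All.++⁺ (All.map (λ {p} (pp , p≡3) → pp , trans (χ-% p) (cong χ p≡3)) (primesMod8-sound 3 x))
                        (All.map (λ {p} (pp , p≡5) → pp , trans (χ-% p) (cong χ p≡5)) (primesMod8-sound 5 x))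

-- The values 0 and 1 equal their squares, so `χ p ≢ χ² p` singles out the value -1, hence the
-- residues 3 and 5.
inert-complete : ∀ {x p} → p ℕ.≤ x → Prime p → χ p ≢ χ² p → p ∈ inert x
inert-complete {x} {p} p≤x prime-p χ≢χ² = [ (λ p≡3 → ∈-++⁺ˡ (primesMod8-complete p≤x (prime-p , p≡3)))
                                    , (λ p≡5 → ∈-++⁺ʳ (primesMod8 3 x) (primesMod8-complete p≤x (prime-p , p≡5))) ]
  (residues₈ {λ r → χ r ≢ χ² r → r ≡ 3 ⊎ r ≡ 5} residue p (subst (λ c → c ≢ c * c) (χ-% p) χ≢χ²))
  where
  residue : ∀ (i : Fin 8) → χ (toℕ i) ≢ χ² (toℕ i) → toℕ i ≡ 3 ⊎ toℕ i ≡ 5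
  residue = from-yes (all? {n = 8} λ i → ¬? (χ (toℕ i) ≟ χ² (toℕ i)) →-dec ((toℕ i ℕ.≟ 3) ⊎-dec (toℕ i ℕ.≟ 5)))

χ≡χ²-product : ∀ ps → All (λ p → χ p ≡ χ² p) ps → χ (product ps) ≡ χ² (product ps)
χ≡χ²-product [] [] = refl
χ≡χ²-product (p ∷ ps) (eq ∷ eqs) = begin
  χ (p ℕ.* product ps)                             ≡⟨ χ-* p (product ps) ⟩
  χ p * χ (product ps)                             ≡⟨ cong₂ _*_ eq (χ≡χ²-product ps eqs) ⟩
  χ² p * χ² (product ps)                           ≡⟨ swap (χ p) (χ (product ps)) ⟩
  (χ p * χ (product ps)) * (χ p * χ (product ps))  ≡⟨ cong (λ c → c * c) (χ-* p (product ps)) ⟨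
  χ² (p ℕ.* product ps)                            ∎
  where
  open ≡-Reasoning
  swap : ∀ a b → a * a * (b * b) ≡ a * b * (a * b)
  swap = solve-∀ ℚ-ring

-- At a number divisible by one of the `ps` both sieved functions vanish, so `f` and `g` are
-- compared only at the others.
sieves-agree : ∀ ps {f g m} → (All (λ p → ¬ p ∣ m) ps → f m ≡ g m) → sieves ps f m ≡ sieves ps g m
sieves-agree [] f≡g = f≡g []
sieves-agree (p ∷ ps) {m = m} f≡g with p ∣? m
... | yes _   = refl
... | no  p∤m = sieves-agree ps (λ all → f≡g (p∤m ∷ all))

-- A prime factor of `m` is at most `x` and not inert, so `χ` is 0 or 1 there; multiplicativity
-- carries this over to `m`.
uninert⇒χ≡χ² : ∀ {x} m → m ℕ.≤ x → All (λ p → ¬ p ∣ m) (inert x) → χ m ≡ χ² m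
uninert⇒χ≡χ² zero _ _ = refl
uninert⇒χ≡χ² {x} m@(suc _) m≤x uninert = subst (λ n → χ n ≡ χ² n) (sym isFactorisation)
  (χ≡χ²-product factors (All.tabulate factor))
  where
  open PrimeFactorisation (factorise m)
  factor : ∀ {p} → p ∈ factors → χ p ≡ χ² p
  factor {p} p∈ with χ p ≟ χ² p
  ... | yes eq = eq
  ... | no neq = ⊥-elim (All.lookup uninert (inert-complete (ℕ.≤-trans (∣⇒≤ p∣m) m≤x) (All.lookup factorsPrime p∈) neq) p∣m)
    where
    p∣m : p ∣ m
    p∣m = subst (p ∣_) (sym isFactorisation) (∈⇒∣product p∈)

-- Up to `x` the sieved `χ²` is the sieved `χ`. Sieving `χ`, whose sums are at most 1, costs one
-- factor `Π (inert x)`, and undoing the sieve for `χ²` costs two more.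
χ²-upper : ∀ x → logSum χ² x ≤ Π (inert x) * Π (inert x) * (Π (inert x) * 1ℚ)
χ²-upper x = logSum-unsieves primes (inert-unique x) (All.map plus (inert-sound x)) sieved x ℕ.≤-refl
  where
  primes : All Prime (inert x)
  primes = All.map proj₁ (inert-sound x)
  minus : ∀ {p} → Prime p × χ p ≡ - 1ℚ → Twist χ (- 1ℚ) p
  minus {p} (_ , χ≡-1) m = trans (χ-* p m) (cong (_* χ m) χ≡-1)
  plus : ∀ {p} → Prime p × χ p ≡ - 1ℚ → Twist χ² 1ℚ p
  plus {p} inert m = trans (cong (λ c → c * c) (minus inert m)) (eq (χ m))
    where
    eq : ∀ c → (- 1ℚ * c) * (- 1ℚ * c) ≡ 1ℚ * (c * c)
    eq = solve-∀ ℚ-ring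
  sieved : ∀ y → y ℕ.≤ x → logSum (sieves (inert x) χ²) y ≤ Π (inert x) * 1ℚ
  sieved y y≤x = ≤-trans
    (≤-reflexive (logSum-cong y λ m m≤y → sym (sieves-agree (inert x) (uninert⇒χ≡χ² m (ℕ.≤-trans m≤y y≤x)))))
    (logSum-sieves-upper χ-bounded primes (inert-unique x) (All.map minus (inert-sound x)) y)

*-mono : ∀ {p q r s} → 0ℚ ≤ p → 0ℚ ≤ r → p ≤ q → r ≤ s → p * r ≤ q * s
*-mono {p} {q} {r} 0≤p 0≤r p≤q r≤s = ≤-trans (*-monoʳ r 0≤r p≤q) (*-monoˡ q (≤-trans 0≤p p≤q) r≤s)

-- If both products were at most `M`, then `Π (inert x)` would be at most `M * M`; the left side of
-- the hypothesis is the bound of `χ²-upper` with `M * M` in its place.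
Π-large : ∀ M x → M * M * (M * M) * (M * M * 1ℚ) < logSum χ² x → M < Π (primesMod8 3 x) ⊎ M < Π (primesMod8 5 x)
Π-large M x H<logSum = decide (M <? Π (primesMod8 3 x)) (M <? Π (primesMod8 5 x))
  where
  P = Π (inert x)
  0≤P : 0ℚ ≤ P
  0≤P = Π-nonneg (inert x)
  S≤ : P ≤ M * M → logSum χ² x ≤ M * M * (M * M) * (M * M * 1ℚ)
  S≤ P≤MM = ≤-trans (χ²-upper x)
    (*-mono (0≤* 0≤P 0≤P) (0≤* 0≤P 0≤1) (*-mono 0≤P 0≤P P≤MM P≤MM) (*-monoʳ 1ℚ 0≤1 P≤MM))
  decide : Dec (M < Π (primesMod8 3 x)) → Dec (M < Π (primesMod8 5 x)) →
           M < Π (primesMod8 3 x) ⊎ M < Π (primesMod8 5 x)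
  decide (yes M<Π₃) _          = inj₁ M<Π₃
  decide (no _)     (yes M<Π₅) = inj₂ M<Π₅
  decide (no M≮Π₃)  (no M≮Π₅)  = ⊥-elim (<-irrefl refl (<-≤-trans H<logSum (S≤
    (subst (_≤ M * M) (sym (Π-++ (primesMod8 3 x) (primesMod8 5 x)))
      (*-mono (Π-nonneg (primesMod8 3 x)) (Π-nonneg (primesMod8 5 x)) (≮⇒≥ M≮Π₃) (≮⇒≥ M≮Π₅))))))

Π-unbounded : ∀ M → ∃[ x ] (M < Π (primesMod8 3 x) ⊎ M < Π (primesMod8 5 x))
Π-unbounded M = map₂ (λ {x} → Π-large M x) (χ²-unbounded (M * M * (M * M) * (M * M * 1ℚ)))

-- Primes congruent to 3 or 5 modulo 8 divide 2 ^ n + 1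

-- The even numbers from `2(a + 1)` to `2(a + b)`. In the application `2(a + b)` is `p - 1`, and `a`
-- and `b` count the even and the odd numbers up to `(p - 1) / 2`.
evens : ℕ → ℕ → ℕ
evens a zero    = 1
evens a (suc b) = 2 ℕ.* (a ℕ.+ suc b) ℕ.* evens a b

odds : ℕ → ℕ → ℕ
odds c zero    = 1
odds c (suc b) = suc (2 ℕ.* c) ℕ.* odds (suc c) b

sgn : ℕ → ℤ.ℤ
sgn zero    = ℤ.1ℤ
sgn (suc b) = ℤ.- sgn b

-- The factors pair off: 2(a + i) + (2(c + b - i) + 1) = p.
evens≡±odds : ∀ {p} a b c → p ≡ suc (2 ℕ.* (a ℕ.+ b ℕ.+ c)) →
  (ℤ.+ p) ℤ.∣ (ℤ.+ evens a b ℤ.- sgn b ℤ.* ℤ.+ odds c b)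
evens≡±odds a zero c _ = ℤ.divides ℤ.0ℤ refl
-- The largest even factor `x` meets the smallest odd factor `y`. Multiplying the induction
-- hypothesis by `x` and adding `p * (sgn b * o)`, with `p = x + y`, replaces `- x` by `y` in front
-- of the odd part.
evens≡±odds {p} a (suc b) c p≡ = subst (ℤ.+ p ℤ.∣_) (begin
    ℤ.+ x ℤ.* (ℤ.+ e ℤ.- sgn b ℤ.* ℤ.+ o) ℤ.+ ℤ.+ p ℤ.* (sgn b ℤ.* ℤ.+ o)
      ≡⟨ cong (λ z → ℤ.+ x ℤ.* (ℤ.+ e ℤ.- sgn b ℤ.* ℤ.+ o) ℤ.+ z ℤ.* (sgn b ℤ.* ℤ.+ o)) (trans (cong ℤ.+_ p≡x+y) (ℤ.pos-+ x y)) ⟩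
    ℤ.+ x ℤ.* (ℤ.+ e ℤ.- sgn b ℤ.* ℤ.+ o) ℤ.+ (ℤ.+ x ℤ.+ ℤ.+ y) ℤ.* (sgn b ℤ.* ℤ.+ o)
      ≡⟨ eq (ℤ.+ x) (ℤ.+ y) (ℤ.+ e) (ℤ.+ o) (sgn b) ⟩
    ℤ.+ x ℤ.* ℤ.+ e ℤ.- (ℤ.- sgn b) ℤ.* (ℤ.+ y ℤ.* ℤ.+ o)
      ≡⟨ cong₂ (λ u v → u ℤ.- (ℤ.- sgn b) ℤ.* v) (ℤ.pos-* x e) (ℤ.pos-* y o) ⟨
    ℤ.+ (x ℕ.* e) ℤ.- (ℤ.- sgn b) ℤ.* ℤ.+ (y ℕ.* o) ∎)
  (ℤ.∣m∣n⇒∣m+n (ℤ.∣n⇒∣m*n (ℤ.+ x) (evens≡±odds a b (suc c) (trans p≡ (cong suc (shift a b c)))))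
               (ℤ.∣m⇒∣m*n (sgn b ℤ.* ℤ.+ o) ℤ.∣-refl))
  where
  open ≡-Reasoning
  x = 2 ℕ.* (a ℕ.+ suc b)
  y = suc (2 ℕ.* c)
  e = evens a b
  o = odds (suc c) b
  shift : ∀ a b c → 2 ℕ.* (a ℕ.+ suc b ℕ.+ c) ≡ 2 ℕ.* (a ℕ.+ b ℕ.+ suc c)
  shift = ℕ.solve-∀
  sum≡ : ∀ a b c → suc (2 ℕ.* (a ℕ.+ suc b ℕ.+ c)) ≡ 2 ℕ.* (a ℕ.+ suc b) ℕ.+ suc (2 ℕ.* c)
  sum≡ = ℕ.solve-∀
  p≡x+y : p ≡ x ℕ.+ y
  p≡x+y = trans p≡ (sum≡ a b c)
  eq : ∀ x y e o s → x ℤ.* (e ℤ.- s ℤ.* o) ℤ.+ (x ℤ.+ y) ℤ.* (s ℤ.* o) ≡ x ℤ.* e ℤ.- (ℤ.- s) ℤ.* (y ℤ.* o)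
  eq = ℤ.solve-∀

sgn-odd : ∀ k → sgn (suc (k ℕ.+ k)) ≡ ℤ.- ℤ.1ℤ
sgn-odd zero    = refl
sgn-odd (suc k) rewrite ℕ.+-suc k k = trans (ℤ.neg-involutive (sgn (suc (k ℕ.+ k)))) (sgn-odd k)

-- An odd number of sign changes turns the difference in `evens≡±odds` into a sum.
evens+odds : ∀ {p} a k → p ≡ suc (2 ℕ.* (a ℕ.+ suc (k ℕ.+ k))) →
  p ∣ evens a (suc (k ℕ.+ k)) ℕ.+ odds 0 (suc (k ℕ.+ k))
evens+odds {p} a k p≡ = ℤ.∣⇒∣ᵤ (subst (ℤ.+ p ℤ.∣_) (begin
    ℤ.+ e ℤ.- sgn b ℤ.* ℤ.+ o       ≡⟨ cong (λ s → ℤ.+ e ℤ.- s ℤ.* ℤ.+ o) (sgn-odd k) ⟩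
    ℤ.+ e ℤ.- (ℤ.- ℤ.1ℤ) ℤ.* ℤ.+ o  ≡⟨ eq (ℤ.+ e) (ℤ.+ o) ⟩
    ℤ.+ e ℤ.+ ℤ.+ o                 ≡⟨ ℤ.pos-+ e o ⟨
    ℤ.+ (e ℕ.+ o)                   ∎)
  (evens≡±odds a b 0 (trans p≡ (cong (λ z → suc (2 ℕ.* z)) (sym (ℕ.+-identityʳ (a ℕ.+ b)))))))
  where
  open ≡-Reasoning
  b = suc (k ℕ.+ k)
  e = evens a b
  o = odds 0 b
  eq : ∀ e o → e ℤ.- (ℤ.- ℤ.1ℤ) ℤ.* o ≡ e ℤ.+ o
  eq = ℤ.solve-∀

-- Doubling every factor of `(a + b) !` gives the even numbers up to `2(a + b)`, which are split at
-- `2a`.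
evens-! : ∀ a b → 2 ℕ.^ (a ℕ.+ b) ℕ.* (a ℕ.+ b) ! ≡ 2 ℕ.^ a ℕ.* a ! ℕ.* evens a b
evens-! a zero rewrite ℕ.+-identityʳ a = sym (ℕ.*-identityʳ _)
evens-! a (suc b) rewrite ℕ.+-suc a b = begin
  2 ℕ.* 2 ℕ.^ (a ℕ.+ b) ℕ.* (suc (a ℕ.+ b) ℕ.* (a ℕ.+ b) !)
    ≡⟨ eq (2 ℕ.^ (a ℕ.+ b)) (suc (a ℕ.+ b)) ((a ℕ.+ b) !) ⟩
  2 ℕ.* suc (a ℕ.+ b) ℕ.* (2 ℕ.^ (a ℕ.+ b) ℕ.* (a ℕ.+ b) !)
    ≡⟨ cong (2 ℕ.* suc (a ℕ.+ b) ℕ.*_) (evens-! a b) ⟩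
  2 ℕ.* suc (a ℕ.+ b) ℕ.* (2 ℕ.^ a ℕ.* a ! ℕ.* evens a b)
    ≡⟨ eq′ (2 ℕ.* suc (a ℕ.+ b)) (2 ℕ.^ a ℕ.* a !) (evens a b) ⟩
  2 ℕ.^ a ℕ.* a ! ℕ.* (2 ℕ.* suc (a ℕ.+ b) ℕ.* evens a b) ∎
  where
  open ≡-Reasoning
  eq : ∀ t s f → 2 ℕ.* t ℕ.* (s ℕ.* f) ≡ 2 ℕ.* s ℕ.* (t ℕ.* f)
  eq = ℕ.solve-∀
  eq′ : ∀ x y e → x ℕ.* (y ℕ.* e) ≡ y ℕ.* (x ℕ.* e)
  eq′ = ℕ.solve-∀

-- The recursion of `odds` splits off the smallest factor, while a growing factorial brings in the
-- largest.
odds-last : ∀ c b → odds c (suc b) ≡ odds c b ℕ.* suc (2 ℕ.* (c ℕ.+ b))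
odds-last c zero = eq c
  where
  eq : ∀ c → suc (2 ℕ.* c) ℕ.* 1 ≡ 1 ℕ.* suc (2 ℕ.* (c ℕ.+ 0))
  eq = ℕ.solve-∀
odds-last c (suc b) = begin
  suc (2 ℕ.* c) ℕ.* odds (suc c) (suc b)                            ≡⟨ cong (suc (2 ℕ.* c) ℕ.*_) (odds-last (suc c) b) ⟩
  suc (2 ℕ.* c) ℕ.* (odds (suc c) b ℕ.* suc (2 ℕ.* (suc c ℕ.+ b)))  ≡⟨ ℕ.*-assoc (suc (2 ℕ.* c)) (odds (suc c) b) _ ⟨
  suc (2 ℕ.* c) ℕ.* odds (suc c) b ℕ.* suc (2 ℕ.* (suc c ℕ.+ b))    ≡⟨ cong (λ z → suc (2 ℕ.* c) ℕ.* odds (suc c) b ℕ.* suc (2 ℕ.* z)) (ℕ.+-suc c b) ⟨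
  suc (2 ℕ.* c) ℕ.* odds (suc c) b ℕ.* suc (2 ℕ.* (c ℕ.+ suc b))    ∎
  where open ≡-Reasoning

-- The new factor `2m + 1` is odd, so the even part stays the same. The even case is a hypothesis so
-- that `even-!` can call this lemma within its own induction.
odd-! : ∀ m → (m ℕ.+ m) ! ≡ 2 ℕ.^ m ℕ.* m ! ℕ.* odds 0 m → (m ℕ.+ suc m) ! ≡ 2 ℕ.^ m ℕ.* m ! ℕ.* odds 0 (suc m)
odd-! m even rewrite ℕ.+-suc m m = begin
  suc (m ℕ.+ m) ℕ.* (m ℕ.+ m) !                     ≡⟨ cong (suc (m ℕ.+ m) ℕ.*_) even ⟩
  suc (m ℕ.+ m) ℕ.* (2 ℕ.^ m ℕ.* m ! ℕ.* odds 0 m)  ≡⟨ eq m (2 ℕ.^ m ℕ.* m !) (odds 0 m) ⟩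
  2 ℕ.^ m ℕ.* m ! ℕ.* (odds 0 m ℕ.* suc (2 ℕ.* m))  ≡⟨ cong (2 ℕ.^ m ℕ.* m ! ℕ.*_) (odds-last 0 m) ⟨
  2 ℕ.^ m ℕ.* m ! ℕ.* odds 0 (suc m)                ∎
  where
  open ≡-Reasoning
  eq : ∀ m x o → suc (m ℕ.+ m) ℕ.* (x ℕ.* o) ≡ x ℕ.* (o ℕ.* suc (2 ℕ.* m))
  eq = ℕ.solve-∀

even-! : ∀ m → (m ℕ.+ m) ! ≡ 2 ℕ.^ m ℕ.* m ! ℕ.* odds 0 m
even-! zero    = refl
even-! (suc m) = begin
  suc (m ℕ.+ suc m) ℕ.* (m ℕ.+ suc m) !                       ≡⟨ cong (suc (m ℕ.+ suc m) ℕ.*_) (odd-! m (even-! m)) ⟩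
  suc (m ℕ.+ suc m) ℕ.* (2 ℕ.^ m ℕ.* m ! ℕ.* odds 0 (suc m))  ≡⟨ eq m (2 ℕ.^ m) (m !) (odds 0 (suc m)) ⟩
  2 ℕ.* 2 ℕ.^ m ℕ.* (suc m ℕ.* m !) ℕ.* odds 0 (suc m)        ∎
  where
  open ≡-Reasoning
  eq : ∀ m t f o → suc (m ℕ.+ suc m) ℕ.* (t ℕ.* f ℕ.* o) ≡ 2 ℕ.* t ℕ.* (suc m ℕ.* f) ℕ.* o
  eq = ℕ.solve-∀

prime∤! : ∀ {p} → Prime p → ∀ {n} → n ℕ.< p → ¬ p ∣ n !
prime∤! prime-p {zero}  _   p∣1 = ¬prime[1] (subst Prime (∣1⇒≡1 p∣1) prime-p)
prime∤! prime-p {suc n} n<p p∣  =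
  [ >⇒∤ n<p , prime∤! prime-p (ℕ.<-trans (ℕ.n<1+n n) n<p) ] (euclidsLemma (suc n) (n !) prime-p p∣)

-- Gauss's argument: 2^h h! is the product of the even numbers up to p - 1, where h = (p - 1) / 2, and
-- those above h are the negatives modulo p of the odd numbers up to h, of which there is an odd number b.
prime∣1+2^half : ∀ {p} a k → let b = suc (k ℕ.+ k) in Prime p → p ≡ suc (2 ℕ.* (a ℕ.+ b)) →
  (a ℕ.+ b) ! ≡ 2 ℕ.^ a ℕ.* a ! ℕ.* odds 0 b → p ∣ suc (2 ℕ.^ (a ℕ.+ b))
-- Modulo `p`, `2^half * half !` is the negative of `half !`, which cancels because `half < p` makes
-- it prime to `p`.
prime∣1+2^half {p} a k prime-p p≡ half!≡ = [ (λ p∣ → p∣) , (λ p∣half! → ⊥-elim (prime∤! prime-p half<p p∣half!)) ]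
  (euclidsLemma (suc (2 ℕ.^ half)) (half !) prime-p (subst (p ∣_) (begin
    2 ℕ.^ a ℕ.* a ! ℕ.* (evens a b ℕ.+ odds 0 b)                    ≡⟨ ℕ.*-distribˡ-+ (2 ℕ.^ a ℕ.* a !) (evens a b) (odds 0 b) ⟩
    2 ℕ.^ a ℕ.* a ! ℕ.* evens a b ℕ.+ 2 ℕ.^ a ℕ.* a ! ℕ.* odds 0 b  ≡⟨ cong₂ ℕ._+_ (evens-! a b) half!≡ ⟨
    2 ℕ.^ half ℕ.* half ! ℕ.+ half !                                ≡⟨ ℕ.+-comm (2 ℕ.^ half ℕ.* half !) (half !) ⟩
    suc (2 ℕ.^ half) ℕ.* half !                                     ∎)
  (∣n⇒∣m*n (2 ℕ.^ a ℕ.* a !) (evens+odds a k p≡))))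
  where
  open ≡-Reasoning
  b = suc (k ℕ.+ k)
  half = a ℕ.+ b
  half<p : half ℕ.< p
  half<p = subst (half ℕ.<_) (sym p≡) (s≤s (ℕ.m≤m+n half (half ℕ.+ 0)))

-- Odd multiples of a fixed `c` are closed under multiplication by odd numbers, which is what a
-- common exponent requires. The values used are `c = 1` for primes 3 modulo 8 and `c = 2` for
-- primes 5 modulo 8.
DividesAtOdd : ℕ → ℕ → ℕ → Set
DividesAtOdd c k p = p ∣ suc (2 ℕ.^ (c ℕ.* suc (2 ℕ.* k)))

-- For `p = 8q + 3` the half is `4q + 1`, and up to it there are `2q` even and `2q + 1` odd numbers.
prime≡3 : ∀ {p} → PrimeMod8 3 p → ∃[ k ] DividesAtOdd 1 k p
prime≡3 {p} (prime-p , p≡3) = a , subst (λ n → p ∣ suc (2 ℕ.^ n)) (exponent a)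
  (prime∣1+2^half a q prime-p (trans (trans (ℕ.m≡m%n+[m/n]*n p 8) (cong (ℕ._+ q ℕ.* 8) p≡3)) (eq q)) (odd-! a (even-! a)))
  where
  q = p ℕ./ 8
  a = q ℕ.+ q
  eq : ∀ q → 3 ℕ.+ q ℕ.* 8 ≡ suc (2 ℕ.* (q ℕ.+ q ℕ.+ suc (q ℕ.+ q)))
  eq = ℕ.solve-∀
  exponent : ∀ a → a ℕ.+ suc a ≡ 1 ℕ.* suc (2 ℕ.* a)
  exponent = ℕ.solve-∀

-- For `p = 8q + 5` the half is `4q + 2`, and up to it there are `2q + 1` even and `2q + 1` odd
-- numbers.
prime≡5 : ∀ {p} → PrimeMod8 5 p → ∃[ k ] DividesAtOdd 2 k p
prime≡5 {p} (prime-p , p≡5) = q , subst (λ n → p ∣ suc (2 ℕ.^ n)) (exponent q)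
  (prime∣1+2^half a q prime-p (trans (trans (ℕ.m≡m%n+[m/n]*n p 8) (cong (ℕ._+ q ℕ.* 8) p≡5)) (eq q)) (even-! a))
  where
  q = p ℕ./ 8
  a = suc (q ℕ.+ q)
  eq : ∀ q → 5 ℕ.+ q ℕ.* 8 ≡ suc (2 ℕ.* (suc (q ℕ.+ q) ℕ.+ suc (q ℕ.+ q)))
  eq = ℕ.solve-∀
  exponent : ∀ q → suc (q ℕ.+ q) ℕ.+ suc (q ℕ.+ q) ≡ 2 ℕ.* suc (2 ℕ.* q)
  exponent = ℕ.solve-∀

1+x∣1+x^odd : ∀ x k → suc x ∣ suc (x ℕ.^ suc (2 ℕ.* k))
1+x∣1+x^odd x zero = subst (λ z → suc x ∣ suc z) (sym (ℕ.*-identityʳ x)) ∣-refl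
1+x∣1+x^odd zero (suc k) = 1∣ _
-- With n the previous odd exponent, `x² (1 + x^n) = (x + 1)(x - 1) + (1 + x^(n + 2))`.
1+x∣1+x^odd x@(suc x-1) (suc k) = subst (λ n → suc x ∣ suc (x ℕ.^ n)) (exponent k)
  (∣m+n∣m⇒∣n (subst (suc x ∣_) (eq x-1 (x ℕ.^ suc (2 ℕ.* k))) (∣n⇒∣m*n (x ℕ.* x) (1+x∣1+x^odd x k))) (m∣m*n x-1))
  where
  exponent : ∀ k → suc (suc (suc (2 ℕ.* k))) ≡ suc (2 ℕ.* suc k)
  exponent = ℕ.solve-∀
  eq : ∀ t y → suc t ℕ.* suc t ℕ.* suc y ≡ suc (suc t) ℕ.* t ℕ.+ suc (suc t ℕ.* (suc t ℕ.* y))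
  eq = ℕ.solve-∀

-- The new index comes from `(2k + 1)(2l + 1) = 2(k + l + 2kl) + 1`.
DividesAtOdd-* : ∀ c k l {p} → DividesAtOdd c k p → DividesAtOdd c (k ℕ.+ l ℕ.+ 2 ℕ.* k ℕ.* l) p
DividesAtOdd-* c k l {p} p∣ = ∣-trans p∣ (subst (λ n → suc (2 ℕ.^ m) ∣ suc n)
  (trans (ℕ.^-*-assoc 2 m (suc (2 ℕ.* l))) (cong (2 ℕ.^_) (eq c k l))) (1+x∣1+x^odd (2 ℕ.^ m) l))
  where
  m = c ℕ.* suc (2 ℕ.* k)
  eq : ∀ c k l → c ℕ.* suc (2 ℕ.* k) ℕ.* suc (2 ℕ.* l) ≡ c ℕ.* suc (2 ℕ.* (k ℕ.+ l ℕ.+ 2 ℕ.* k ℕ.* l))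
  eq = ℕ.solve-∀

common-exponent : ∀ c {ps} → All (λ p → ∃[ k ] DividesAtOdd c k p) ps → ∃[ k ] All (DividesAtOdd c k) ps
common-exponent c [] = 0 , []
common-exponent c {p ∷ ps} ((k , p∣) ∷ rest) with common-exponent c rest
... | l , ps∣ = k ℕ.+ l ℕ.+ 2 ℕ.* k ℕ.* l
              , DividesAtOdd-* c k l p∣ ∷ All.map (λ {q} q∣ → subst (λ j → DividesAtOdd c j q) (eq k l) (DividesAtOdd-* c l k q∣)) ps∣
  where
  eq : ∀ k l → l ℕ.+ k ℕ.+ 2 ℕ.* l ℕ.* k ≡ k ℕ.+ l ℕ.+ 2 ℕ.* k ℕ.* l
  eq = ℕ.solve-∀

-- The divisor sum

-- Write `n = m * p`: every other prime of the list divides `m * p` but not `p`, hence divides `m`,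
-- and the induction continues with `m`.
product∣ : ∀ {ps n} → All Prime ps → Unique ps → All (_∣ n) ps → product ps ∣ n
product∣ [] [] [] = 1∣ _
product∣ {p ∷ ps} {n} (prime-p ∷ primes) (p∉ps ∷ unique) (divides m n≡m*p ∷ ps∣n) =
  subst (p ℕ.* product ps ∣_) (trans (ℕ.*-comm p m) (sym n≡m*p))
    (*-monoʳ-∣ p (product∣ primes unique (All.zipWith cofactor (All.zip (primes , p∉ps) , ps∣n))))
  where
  cofactor : ∀ {q} → (Prime q × p ≢ q) × q ∣ n → q ∣ m
  cofactor {q} ((prime-q , p≢q) , q∣n) = [ (λ q∣m → q∣m) , (λ q∣p → ⊥-elim (p≢q (sym (∣prime⇒≡ prime-q prime-p q∣p)))) ]
    (euclidsLemma m p prime-q (subst (q ∣_) n≡m*p q∣n))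

∤product : ∀ {p ps} → Prime p → All Prime ps → All (p ≢_) ps → ¬ p ∣ product ps
∤product prime-p [] [] p∣1 = ¬prime[1] (subst Prime (∣1⇒≡1 p∣1) prime-p)
∤product {p} {q ∷ ps} prime-p (prime-q ∷ primes) (p≢q ∷ p∉ps) p∣ =
  [ p≢q ∘ ∣prime⇒≡ prime-p prime-q , ∤product prime-p primes p∉ps ] (euclidsLemma q (product ps) prime-p p∣)

-- One occurrence of the head is cut out of `ys`; uniqueness keeps the tail of `xs` inside what
-- remains.
sum-mono-⊆ : ∀ {xs ys} → Unique xs → (∀ {x} → x ∈ xs → x ∈ ys) → sum xs ℕ.≤ sum ys
sum-mono-⊆ [] _ = z≤n
sum-mono-⊆ {x ∷ xs} (x∉xs ∷ unique) xs⊆ys with ∈-∃++ (xs⊆ys (here refl))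
... | us , vs , refl = begin
  x ℕ.+ sum xs               ≤⟨ ℕ.+-monoʳ-≤ x (sum-mono-⊆ unique xs⊆us++vs) ⟩
  x ℕ.+ sum (us ++ vs)       ≡⟨ cong (x ℕ.+_) (sum-++ us vs) ⟩
  x ℕ.+ (sum us ℕ.+ sum vs)  ≡⟨ eq x (sum us) (sum vs) ⟩
  sum us ℕ.+ sum (x ∷ vs)    ≡⟨ sum-++ us (x ∷ vs) ⟨
  sum (us ++ x ∷ vs)         ∎
  where
  open ℕ.≤-Reasoning
  eq : ∀ x u v → x ℕ.+ (u ℕ.+ v) ≡ u ℕ.+ (x ℕ.+ v)
  eq = ℕ.solve-∀
  xs⊆us++vs : ∀ {z} → z ∈ xs → z ∈ us ++ vs
  xs⊆us++vs z∈xs with ∈-++⁻ us (xs⊆ys (there z∈xs))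
  ... | inj₁ z∈us         = ∈-++⁺ˡ z∈us
  ... | inj₂ (here refl)  = ⊥-elim (All.lookup x∉xs z∈xs refl)
  ... | inj₂ (there z∈vs) = ∈-++⁺ʳ us z∈vs

sum-map-* : ∀ c xs → sum (map (c ℕ.*_) xs) ≡ c ℕ.* sum xs
sum-map-* c []       = sym (ℕ.*-zeroʳ c)
sum-map-* c (x ∷ xs) = trans (cong (c ℕ.* x ℕ.+_) (sum-map-* c xs)) (sym (ℕ.*-distribˡ-+ c x (sum xs)))

divisors-unique : ∀ m → Unique (divisors m)
divisors-unique m = Unique.filter⁺ (_∣? m) (Unique.map⁺ ℕ.suc-injective (Unique.upTo⁺ m))

∈divisors⇒∣ : ∀ {d} m → d ∈ divisors m → d ∣ m
∈divisors⇒∣ m d∈ = proj₂ (∈-filter⁻ (_∣? m) {xs = map suc (upTo m)} d∈)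

∣⇒∈divisors : ∀ {d} m .{{_ : NonZero m}} → d ∣ m → d ∈ divisors m
∣⇒∈divisors {zero}  (suc m) (divides q eq) with trans eq (ℕ.*-zeroʳ q)
... | ()
∣⇒∈divisors {suc d} m d∣m = ∈-filter⁺ (_∣? m) (∈-map⁺ suc (∈-upTo⁺ (∣⇒≤ d∣m))) d∣m

-- Multiplication by `c` injects the divisors of `m` into those of `c * m`. Dividing by `c * m`
-- gives `h m ≤ h (c * m)`.
*σ≤σ* : ∀ c m .{{_ : NonZero c}} .{{_ : NonZero (c ℕ.* m)}} → c ℕ.* σ m ℕ.≤ σ (c ℕ.* m)
*σ≤σ* c m = subst (ℕ._≤ σ (c ℕ.* m)) (sum-map-* c (divisors m))
  (sum-mono-⊆ (Unique.map⁺ (ℕ.*-cancelˡ-≡ _ _ c) (divisors-unique m)) subset)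
  where
  subset : ∀ {x} → x ∈ map (c ℕ.*_) (divisors m) → x ∈ divisors (c ℕ.* m)
  subset x∈ with ∈-map⁻ (c ℕ.*_) x∈
  ... | d , d∈ , refl = ∣⇒∈divisors (c ℕ.* m) (*-monoʳ-∣ c (∈divisors⇒∣ m d∈))

-- The divisors `d` of `m` and their multiples `p * d` all divide `p * m`, and the two families are
-- disjoint because `p` does not divide `m`.
1+p*σ≤σ[p*] : ∀ p m .{{_ : NonZero p}} .{{_ : NonZero (p ℕ.* m)}} → ¬ p ∣ m → suc p ℕ.* σ m ℕ.≤ σ (p ℕ.* m)
1+p*σ≤σ[p*] p m p∤m = subst (ℕ._≤ σ (p ℕ.* m))
  (trans (sum-++ (divisors m) (map (p ℕ.*_) (divisors m))) (cong (σ m ℕ.+_) (sum-map-* p (divisors m))))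
  (sum-mono-⊆ (Unique.++⁺ (divisors-unique m) (Unique.map⁺ (ℕ.*-cancelˡ-≡ _ _ p) (divisors-unique m)) disjoint) subset)
  where
  disjoint : ∀ {x} → ¬ (x ∈ divisors m × x ∈ map (p ℕ.*_) (divisors m))
  disjoint (x∈ , x∈p*) with ∈-map⁻ (p ℕ.*_) x∈p*
  ... | d , _ , refl = p∤m (∣-trans (m∣m*n d) (∈divisors⇒∣ m x∈))
  subset : ∀ {x} → x ∈ divisors m ++ map (p ℕ.*_) (divisors m) → x ∈ divisors (p ℕ.* m)
  subset x∈ with ∈-++⁻ (divisors m) x∈
  ... | inj₁ x∈m = ∣⇒∈divisors (p ℕ.* m) (∣n⇒∣m*n p (∈divisors⇒∣ m x∈m))
  ... | inj₂ x∈p* with ∈-map⁻ (p ℕ.*_) x∈p*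
  ...   | d , d∈ , refl = ∣⇒∈divisors (p ℕ.* m) (*-monoʳ-∣ p (∈divisors⇒∣ m d∈))

product-suc≤σ : ∀ {ps} → All Prime ps → Unique ps → product (map suc ps) ℕ.≤ σ (product ps)
product-suc≤σ [] [] = s≤s z≤n
product-suc≤σ {p ∷ ps} (prime-p ∷ primes) (p∉ps ∷ unique) = ℕ.≤-trans
  (ℕ.*-monoʳ-≤ (suc p) (product-suc≤σ primes unique))
  (1+p*σ≤σ[p*] p (product ps) {{prime⇒nonZero prime-p}} {{productOfPrimes≢0 (prime-p ∷ primes)}} (∤product prime-p primes p∉ps))

Π-*-product : ∀ {ps} → All Prime ps → Π ps * ι (product ps) ≡ ι (product (map suc ps))
Π-*-product [] = refl
Π-*-product {p ∷ ps} (prime-p ∷ primes) = begin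
  (1ℚ + recip p) * Π ps * ι (p ℕ.* product ps)     ≡⟨ cong ((1ℚ + recip p) * Π ps *_) (ι-* p (product ps)) ⟩
  (1ℚ + recip p) * Π ps * (ι p * ι (product ps))   ≡⟨ eq (recip p) (Π ps) (ι p) (ι (product ps)) ⟩
  (ι p * recip p + ι p) * (Π ps * ι (product ps))  ≡⟨ cong₂ (λ z w → (z + ι p) * w) (recip-inverse p {{prime⇒nonZero prime-p}}) (Π-*-product primes) ⟩
  (1ℚ + ι p) * ι (product (map suc ps))            ≡⟨ cong (_* ι (product (map suc ps))) (ι-+ 1 p) ⟨
  ι (suc p) * ι (product (map suc ps))             ≡⟨ ι-* (suc p) (product (map suc ps)) ⟨
  ι (suc p ℕ.* product (map suc ps))               ∎
  where
  open ≡-Reasoning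
  eq : ∀ u P i j → (1ℚ + u) * P * (i * j) ≡ (i * u + i) * (P * j)
  eq = solve-∀ ℚ-ring

-- With N the product of the primes and `n = c * N`, `Π ps * N` is the product of the `p + 1`, which
-- is at most `σ N`, and `c * σ N ≤ σ n`.
Π≤h : ∀ {ps} n .{{_ : NonZero n}} → All Prime ps → Unique ps → All (_∣ n) ps → Π ps ≤ h n
Π≤h {ps} n@(suc n-1) primes unique ps∣n with product∣ primes unique ps∣n
... | divides c@(suc c-1) n≡ = begin
  Π ps                    ≡⟨ *-identityʳ (Π ps) ⟨
  Π ps * 1ℚ               ≡⟨ cong (Π ps *_) (recip-inverse n) ⟨
  Π ps * (ι n * recip n)  ≡⟨ *-assoc (Π ps) (ι n) (recip n) ⟨
  Π ps * ι n * recip n    ≤⟨ *-monoʳ (recip n) (recip-nonneg n) Π*n≤σ ⟩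
  ι (σ n) * recip n       ≡⟨ /-as-* (σ n) n ⟨
  h n                     ∎
  where
  open ≤-Reasoning
  eq : ∀ a b d → a * (b * d) ≡ b * (a * d)
  eq = solve-∀ ℚ-ring
  Π*n≤σ : Π ps * ι n ≤ ι (σ n)
  Π*n≤σ = begin
    Π ps * ι n                      ≡⟨ cong (λ z → Π ps * ι z) n≡ ⟩
    Π ps * ι (c ℕ.* product ps)     ≡⟨ cong (Π ps *_) (ι-* c (product ps)) ⟩
    Π ps * (ι c * ι (product ps))   ≡⟨ eq (Π ps) (ι c) (ι (product ps)) ⟩
    ι c * (Π ps * ι (product ps))   ≡⟨ cong (ι c *_) (Π-*-product primes) ⟩
    ι c * ι (product (map suc ps))  ≡⟨ ι-* c (product (map suc ps)) ⟨
    ι (c ℕ.* product (map suc ps))  ≤⟨ ι-mono-≤ (ℕ.*-monoʳ-≤ c (product-suc≤σ primes unique)) ⟩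
    ι (c ℕ.* σ (product ps))        ≤⟨ ι-mono-≤ (*σ≤σ* c (product ps) {{_}} {{subst NonZero n≡ _}}) ⟩
    ι (σ (c ℕ.* product ps))        ≡⟨ cong (λ z → ι (σ z)) n≡ ⟨
    ι (σ n)                         ∎

Π≤K : ∀ c .{{_ : NonZero c}} {ps} → All Prime ps → Unique ps → All (λ p → ∃[ k ] DividesAtOdd c k p) ps →
  ∃[ n ] (n ≥ 1 × Π ps ≤ K n)
Π≤K c@(suc _) primes unique exponents with common-exponent c exponents
... | k , ps∣ = c ℕ.* suc (2 ℕ.* k) , s≤s z≤n , Π≤h (suc (2 ℕ.^ (c ℕ.* suc (2 ℕ.* k)))) primes unique ps∣

theorem11 : (C : ℚ) → ∃[ n ] (n ≥ 1 × C < K n)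
theorem11 C = bounded (Π-unbounded C)
  where
  bounded : ∃[ x ] (C < Π (primesMod8 3 x) ⊎ C < Π (primesMod8 5 x)) → ∃[ n ] (n ≥ 1 × C < K n)
  -- The exponents are odd for the class of 3 and twice odd for the class of 5, so they never
  -- coincide and each class gets its own `n`.
  bounded (x , inj₁ C<Π) = map₂ (map₂ (<-≤-trans C<Π))
    (Π≤K 1 (All.map proj₁ (primesMod8-sound 3 x)) (primesMod8-unique 3 x) (All.map prime≡3 (primesMod8-sound 3 x)))
  bounded (x , inj₂ C<Π) = map₂ (map₂ (<-≤-trans C<Π))
    (Π≤K 2 (All.map proj₁ (primesMod8-sound 5 x)) (primesMod8-unique 5 x) (All.map prime≡5 (primesMod8-sound 5 x)))
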